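{- (Equivalence) Let $\mathcal R$ be a polarized rewrite system such that $\longrightarrow_{ - }$ and $\longrightarrow_{+}$ commute. Let $\mathcal T$ be the set of propositions consisting of $P \Rightarrow A$ for each negative rule $P \longrightarrow A$ of $\mathcal R$ and $A \Rightarrow P$ for each positive rule $P \longrightarrow A$ of $\mathcal R$. Then for every finite set of propositions $\Gamma$ and every proposition $A$: $\Gamma \vdash_{\mathcal R} A$ if and only if $\mathcal T, \Gamma \vdash A$.
   Context: Propositions are built from atomic propositions (propositional symbols) and the constant $\bot$ using the binary connectives $\Rightarrow$, $\wedge$, $\vee$; $\neg A$ abbreviates $A\Rightarrow\bot$. A rewrite rule is a pair $P \longrightarrow A$ with $P$ an atomic proposition and $A$ an arbitrary proposition. A polarized rewrite system $\mathcal R = \langle \mathcal R_{ - }, \mathcal R_{+}\rangle$ is a pair of sets of rewrite rules; rules of $\mathcal R_{ - }$ are called negative, those of $\mathcal R_{+}$ positive. The one-step relations $\longrightarrow^1_{ - }$, $\longrightarrow^1_{+}$ are the least relations on propositions such that: $P \longrightarrow^1_{ - } A$ for every negative rule $P \longrightarrow A$; $P \longrightarrow^1_{+} A$ for every positive rule $P\longrightarrow A$; $A \Rightarrow B \longrightarrow^1_{ - } A' \Rightarrow B$ if $A \longrightarrow^1_{+} A'$, and $A \Rightarrow B \longrightarrow^1_{ - } A \Rightarrow B'$ if $B \longrightarrow^1_{ - } B'$; $A \Rightarrow B \longrightarrow^1_{+} A' \Rightarrow B$ if $A \longrightarrow^1_{ - } A'$, and $A \Rightarrow B \longrightarrow^1_{+}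 A \Rightarrow B'$ if $B \longrightarrow^1_{+} B'$; for $\circ \in \{\wedge, \vee\}$ and $s \in \{ -,+\}$, $A \circ B \longrightarrow^1_{s} A' \circ B$ if $A \longrightarrow^1_{s} A'$, and $A \circ B \longrightarrow^1_{s} A \circ B'$ if $B \longrightarrow^1_{s} B'$. The relations $\longrightarrow_{ - }$, $\longrightarrow_{+}$ are the reflexive-transitive closures of $\longrightarrow^1_{ - }$, $\longrightarrow^1_{+}$; $B \longleftarrow_{s} A$ means $A \longrightarrow_{s} B$. They commute if whenever $A \longleftarrow_{ - } B \longrightarrow_{+} C$ there is $D$ with $A \longrightarrow_{+} D \longleftarrow_{ - } C$. Polarized (intuitionistic) natural deduction modulo $\mathcal R$ derives sequents $\Gamma \vdash_{\mathcal R} A$ ($\Gamma$ a finite set of propositions) by the rules: (axiom) $\Gamma\vdash_{\mathcal R} B$ if $A\in\Gamma$ and $A\longrightarrow_{ - }C\longleftarrow_{+}B$ for some $C$; ($\Rightarrow$-intro) from $\Gamma,A\vdash_{\mathcal R}B$ infer $\Gamma\vdash_{\mathcal R}C$ if $C\longrightarrow_{+}(A\Rightarrow B)$; ($\Rightarrow$-elim) from $\Gamma\vdash_{\mathcal R}C$ and $\Gamma\vdash_{\mathcal R}A$ infer $\Gamma\vdash_{\mathcal R}B$ if $C\longrightarrow_{ - }(A\Rightarrow B)$; ($\wedge$-intro) from $\Gamma\vdash_{\mathcal R}A$ and $\Gamma\vdash_{\mathcal R}B$ infer $\Gamma\vdash_{\mathcal R}C$ if $C\longrightarrow_{+}(A\wedge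 B)$; ($\wedge$-elim) from $\Gamma\vdash_{\mathcal R}C$ infer $\Gamma\vdash_{\mathcal R}A$ and $\Gamma\vdash_{\mathcal R}B$ if $C\longrightarrow_{ - }(A\wedge B)$; ($\vee$-intro) from $\Gamma\vdash_{\mathcal R}A$ or from $\Gamma\vdash_{\mathcal R}B$ infer $\Gamma\vdash_{\mathcal R}C$ if $C\longrightarrow_{+}(A\vee B)$; ($\vee$-elim) from $\Gamma\vdash_{\mathcal R}D$, $\Gamma,A\vdash_{\mathcal R}C$, $\Gamma,B\vdash_{\mathcal R}C$ infer $\Gamma\vdash_{\mathcal R}C$ if $D\longrightarrow_{ - }(A\vee B)$; ($\bot$-elim) from $\Gamma\vdash_{\mathcal R}B$ infer $\Gamma\vdash_{\mathcal R}A$ if $B\longrightarrow_{ - }\bot$. The relation $\vdash$ (without subscript) is ordinary intuitionistic propositional natural deduction, i.e. the same system for the empty rewrite system; for a possibly infinite set $\mathcal T$, $\mathcal T,\Gamma\vdash A$ means $\mathcal T_0,\Gamma\vdash A$ for some finite $\mathcal T_0\subseteq\mathcal T$. -}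

module Defs where

open import Data.Product using (Σ; _×_; _,_; ∃)
open import Data.Sum using (_⊎_)
open import Data.List using (List; []; _∷_; _++_)
open import Data.List.Membership.Propositional using (_∈_)
open import Data.List.Relation.Unary.All using (All)
open import Relation.Binary.Construct.Closure.ReflexiveTransitive using (Star)

module _ (Atom : Set) where

  -- Propositions over a set of atomic propositions
  data Prop : Set where
    atom : Atom → Prop
    ⊥'   : Prop
    _⇒_  : Prop → Prop → Prop
    _∧_  : Prop → Prop → Prop
    _∨_  : Prop → Prop → Prop

  infixr 4 _⇒_
  infixr 6 _∧_
  infixr 5 _∨_

  ¬' : Prop → Prop
  ¬' A = A ⇒ ⊥'

  -- A rewrite rule P ⟶ A, with P atomic
  Rule : Set
  Rule = Atom × Prop

  -- A set of rules (possibly infinite) is a predicate on rules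
  RuleSet : Set₁
  RuleSet = Rule → Set

  -- Polarized rewrite system ⟨ R₋ , R₊ ⟩
  record Polarized : Set₁ where
    constructor ⟨_,_⟩
    field
      neg : RuleSet
      pos : RuleSet

  data Sign : Set where
    - + : Sign

  flip : Sign → Sign
  flip - = +
  flip + = -

  module _ (R : Polarized) where
    open Polarized R

    rules : Sign → RuleSet
    rules - = neg
    rules + = pos

    -- one-step polarized rewriting  A ⟶¹ₛ B
    data Step : Sign → Prop → Prop → Set where
      rule : ∀ {s P A} → rules s (P , A) → Step s (atom P) A
      ⇒ₗ   : ∀ {s A A' B} → Step (flip s) A A' → Step s (A ⇒ B) (A' ⇒ B)
      ⇒ᵣ   : ∀ {s A B B'} → Step s B B' → Step s (A ⇒ B) (A ⇒ B')
      ∧ₗ   : ∀ {s A A' B} → Step s A A' → Step s (A ∧ B) (A' ∧ B)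
      ∧ᵣ   : ∀ {s A B B'} → Step s B B' → Step s (A ∧ B) (A ∧ B')
      ∨ₗ   : ∀ {s A A' B} → Step s A A' → Step s (A ∨ B) (A' ∨ B)
      ∨ᵣ   : ∀ {s A B B'} → Step s B B' → Step s (A ∨ B) (A ∨ B')

    -- reflexive-transitive closure  A ⟶ₛ B
    Steps : Sign → Prop → Prop → Set
    Steps s = Star (Step s)

    -- ⟶₋ and ⟶₊ commute
    Commute : Set
    Commute = ∀ {A B C} → Steps - B A → Steps + B C →
              Σ Prop (λ D → Steps + A D × Steps - C D)

    -- polarized natural deduction modulo R
    data _⊢_ (Γ : List Prop) : Prop → Set where
      ax    : ∀ {A B C} → A ∈ Γ → Steps - A C → Steps + B C → Γ ⊢ B
      ⇒-i   : ∀ {A B C} → Steps + C (A ⇒ B) → (A ∷ Γ) ⊢ B → Γ ⊢ C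
      ⇒-e   : ∀ {A B C} → Steps - C (A ⇒ B) → Γ ⊢ C → Γ ⊢ A → Γ ⊢ B
      ∧-i   : ∀ {A B C} → Steps + C (A ∧ B) → Γ ⊢ A → Γ ⊢ B → Γ ⊢ C
      ∧-e₁  : ∀ {A B C} → Steps - C (A ∧ B) → Γ ⊢ C → Γ ⊢ A
      ∧-e₂  : ∀ {A B C} → Steps - C (A ∧ B) → Γ ⊢ C → Γ ⊢ B
      ∨-i₁  : ∀ {A B C} → Steps + C (A ∨ B) → Γ ⊢ A → Γ ⊢ C
      ∨-i₂  : ∀ {A B C} → Steps + C (A ∨ B) → Γ ⊢ B → Γ ⊢ C
      ∨-e   : ∀ {A B C D} → Steps - D (A ∨ B) → Γ ⊢ D →
              (A ∷ Γ) ⊢ C → (B ∷ Γ) ⊢ C → Γ ⊢ C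
      ⊥-e   : ∀ {A B} → Steps - B ⊥' → Γ ⊢ B → Γ ⊢ A

  -- the empty rewrite system
  ∅ : Polarized
  ∅ = ⟨ (λ _ → Data.Empty.⊥) , (λ _ → Data.Empty.⊥) ⟩
    where import Data.Empty

  -- ordinary intuitionistic natural deduction
  _⊢₀_ : List Prop → Prop → Set
  Γ ⊢₀ A = _⊢_ ∅ Γ A

  -- the theory T associated with R:  P ⇒ A for negative rules, A ⇒ P for positive rules
  Theory : Polarized → Prop → Set
  Theory R B =
    (Σ Rule λ r → Polarized.neg R r × B ≡ (atom (Data.Product.proj₁ r) ⇒ Data.Product.proj₂ r))
    ⊎ (Σ Rule λ r → Polarized.pos R r × B ≡ (Data.Product.proj₂ r ⇒ atom (Data.Product.proj₁ r)))
    where open import Relation.Binary.PropositionalEquality using (_≡_)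
          import Data.Product

  -- 𝒯, Γ ⊢ A : some finite T₀ ⊆ 𝒯 with T₀ ∪ Γ ⊢ A
  _,_⊢ₜ_ : (Prop → Set) → List Prop → Prop → Set
  𝒯 , Γ ⊢ₜ A = Σ (List Prop) λ T₀ → All 𝒯 T₀ × ((T₀ ++ Γ) ⊢₀ A)

-- Each rewrite step is an implication provable from 𝒯: a negative step P ⟶ A is the axiom
-- P ⇒ A, a positive one is A ⇒ P, and congruence closure preserves this because the
-- polarities follow the variance of the connectives. So every rewrite in a polarized
-- derivation can be replaced by modus ponens with finitely many axioms of 𝒯. Conversely
-- every axiom of 𝒯 is provable modulo R by a single rewrite at an axiom leaf, and these
-- proofs can be cut in with ⇒-introduction followed by ⇒-elimination.
module Submission where

open import Defs
open import Data.List using (List; []; _∷_; _++_)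
open import Data.List.Membership.Propositional using (_∈_)
open import Data.List.Relation.Binary.Subset.Propositional using (_⊆_)
open import Data.List.Relation.Binary.Subset.Propositional.Properties
  using (⊆-trans; ∷⁺ʳ; xs⊆xs++ys; xs⊆ys++xs)
open import Data.List.Relation.Unary.Any using (here; there)
open import Data.List.Relation.Unary.All using (All; []; _∷_)
open import Data.List.Relation.Unary.All.Properties using (++⁺)
open import Data.Product using (Σ; _×_; _,_)
open import Data.Sum using (inj₁; inj₂)
open import Function using (id; _∘_)
open import Function.Bundles using (_⇔_; mk⇔)
open import Relation.Binary.Construct.Closure.ReflexiveTransitive using (ε; _◅_; map)
open import Relation.Binary.PropositionalEquality using (refl)

module _ {Atom : Set} where

  private variable
    A A′ B B′ C : Prop Atom
    Γ Δ T : List (Prop Atom)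
    R R′ : Polarized Atom
    s : Sign Atom

  infix 2 _⊢[_]_
  _⊢[_]_ : List (Prop Atom) → Polarized Atom → Prop Atom → Set
  Γ ⊢[ R ] A = _⊢_ Atom R Γ A

  module Axiomatic (Th : Prop Atom → Set) where

    infix 2 _⊢ᵀ_
    data _⊢ᵀ_ (Γ : List (Prop Atom)) : Prop Atom → Set where
      hyp : A ∈ Γ → Γ ⊢ᵀ A
      axm : Th A → Γ ⊢ᵀ A
      ⇒I  : A ∷ Γ ⊢ᵀ B → Γ ⊢ᵀ A ⇒ B
      ⇒E  : Γ ⊢ᵀ A ⇒ B → Γ ⊢ᵀ A → Γ ⊢ᵀ B
      ∧I  : Γ ⊢ᵀ A → Γ ⊢ᵀ B → Γ ⊢ᵀ A ∧ B
      ∧E₁ : Γ ⊢ᵀ A ∧ B → Γ ⊢ᵀ A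
      ∧E₂ : Γ ⊢ᵀ A ∧ B → Γ ⊢ᵀ B
      ∨I₁ : Γ ⊢ᵀ A → Γ ⊢ᵀ A ∨ B
      ∨I₂ : Γ ⊢ᵀ B → Γ ⊢ᵀ A ∨ B
      ∨E  : Γ ⊢ᵀ A ∨ B → A ∷ Γ ⊢ᵀ C → B ∷ Γ ⊢ᵀ C → Γ ⊢ᵀ C
      ⊥E  : Γ ⊢ᵀ ⊥' → Γ ⊢ᵀ A

    weakenᵀ : Γ ⊆ Δ → Γ ⊢ᵀ A → Δ ⊢ᵀ A
    weakenᵀ Γ⊆Δ (hyp A∈Γ)  = hyp (Γ⊆Δ A∈Γ)
    weakenᵀ Γ⊆Δ (axm t)    = axm t
    weakenᵀ Γ⊆Δ (⇒I d)     = ⇒I (weakenᵀ (∷⁺ʳ _ Γ⊆Δ) d)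
    weakenᵀ Γ⊆Δ (⇒E d e)   = ⇒E (weakenᵀ Γ⊆Δ d) (weakenᵀ Γ⊆Δ e)
    weakenᵀ Γ⊆Δ (∧I d e)   = ∧I (weakenᵀ Γ⊆Δ d) (weakenᵀ Γ⊆Δ e)
    weakenᵀ Γ⊆Δ (∧E₁ d)    = ∧E₁ (weakenᵀ Γ⊆Δ d)
    weakenᵀ Γ⊆Δ (∧E₂ d)    = ∧E₂ (weakenᵀ Γ⊆Δ d)
    weakenᵀ Γ⊆Δ (∨I₁ d)    = ∨I₁ (weakenᵀ Γ⊆Δ d)
    weakenᵀ Γ⊆Δ (∨I₂ d)    = ∨I₂ (weakenᵀ Γ⊆Δ d)
    weakenᵀ Γ⊆Δ (∨E d e f) =
      ∨E (weakenᵀ Γ⊆Δ d) (weakenᵀ (∷⁺ʳ _ Γ⊆Δ) e) (weakenᵀ (∷⁺ʳ _ Γ⊆Δ) f)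
    weakenᵀ Γ⊆Δ (⊥E d)     = ⊥E (weakenᵀ Γ⊆Δ d)

    infix 2 _≼_
    _≼_ : Prop Atom → Prop Atom → Set
    A ≼ B = ∀ {Γ} → Γ ⊢ᵀ A → Γ ⊢ᵀ B

    ⇒-mono : A′ ≼ A → B ≼ B′ → A ⇒ B ≼ A′ ⇒ B′
    ⇒-mono A′≼A B≼B′ d = ⇒I (B≼B′ (⇒E (weakenᵀ there d) (A′≼A (hyp (here refl)))))

    ∧-mono : A ≼ A′ → B ≼ B′ → A ∧ B ≼ A′ ∧ B′
    ∧-mono A≼A′ B≼B′ d = ∧I (A≼A′ (∧E₁ d)) (B≼B′ (∧E₂ d))

    ∨-mono : A ≼ A′ → B ≼ B′ → A ∨ B ≼ A′ ∨ B′
    ∨-mono A≼A′ B≼B′ d = ∨E d (∨I₁ (A≼A′ (hyp (here refl)))) (∨I₂ (B≼B′ (hyp (here refl))))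

    -- The used axioms T₀ are kept separate from the hypotheses and the conclusion is
    -- derivable in every context containing both, so the binary and binding rules need
    -- no reshuffling of T₀ ++ Γ.
    FinitelySupported : List (Prop Atom) → Prop Atom → Set
    FinitelySupported Γ A =
      Σ (List (Prop Atom)) λ T₀ → All Th T₀ × (∀ {Δ} → T₀ ⊆ Δ → Γ ⊆ Δ → Δ ⊢[ ∅ Atom ] A)

    mapSupported : (∀ {Δ} → Δ ⊢[ ∅ Atom ] A → Δ ⊢[ ∅ Atom ] B) →
                   FinitelySupported Γ A → FinitelySupported Γ B
    mapSupported f (T , t , d) = T , t , λ T⊆Δ Γ⊆Δ → f (d T⊆Δ Γ⊆Δ)

    zipSupported : (∀ {Δ} → Δ ⊢[ ∅ Atom ] A → Δ ⊢[ ∅ Atom ] B → Δ ⊢[ ∅ Atom ] C) →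
                   FinitelySupported Γ A → FinitelySupported Γ B → FinitelySupported Γ C
    zipSupported f (T , t , d) (U , u , e) = T ++ U , ++⁺ t u , λ TU⊆Δ Γ⊆Δ →
      f (d (⊆-trans (xs⊆xs++ys T U) TU⊆Δ) Γ⊆Δ) (e (⊆-trans (xs⊆ys++xs U T) TU⊆Δ) Γ⊆Δ)

    finitelySupported : Γ ⊢ᵀ A → FinitelySupported Γ A
    finitelySupported (hyp A∈Γ) = [] , [] , λ _ Γ⊆Δ → ax (Γ⊆Δ A∈Γ) ε ε
    finitelySupported (axm t)   = _ ∷ [] , t ∷ [] , λ T⊆Δ _ → ax (T⊆Δ (here refl)) ε ε
    finitelySupported (⇒I d) with finitelySupported d
    ... | T , t , d′ = T , t , λ T⊆Δ Γ⊆Δ → ⇒-i ε (d′ (there ∘ T⊆Δ) (∷⁺ʳ _ Γ⊆Δ))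
    finitelySupported (⇒E d e)  = zipSupported (⇒-e ε) (finitelySupported d) (finitelySupported e)
    finitelySupported (∧I d e)  = zipSupported (∧-i ε) (finitelySupported d) (finitelySupported e)
    finitelySupported (∧E₁ d)   = mapSupported (∧-e₁ ε) (finitelySupported d)
    finitelySupported (∧E₂ d)   = mapSupported (∧-e₂ ε) (finitelySupported d)
    finitelySupported (∨I₁ d)   = mapSupported (∨-i₁ ε) (finitelySupported d)
    finitelySupported (∨I₂ d)   = mapSupported (∨-i₂ ε) (finitelySupported d)
    finitelySupported (⊥E d)    = mapSupported (⊥-e ε) (finitelySupported d)
    finitelySupported (∨E d e f)
      with finitelySupported d | finitelySupported e | finitelySupported f
    ... | T , t , d′ | U , u , e′ | V , v , f′ = T ++ U ++ V , ++⁺ t (++⁺ u v) ,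
      λ TUV⊆Δ Γ⊆Δ →
        let UV⊆Δ = ⊆-trans (xs⊆ys++xs (U ++ V) T) TUV⊆Δ
        in ∨-e ε (d′ (⊆-trans (xs⊆xs++ys T _) TUV⊆Δ) Γ⊆Δ)
             (e′ (there ∘ ⊆-trans (xs⊆xs++ys U V) UV⊆Δ) (∷⁺ʳ _ Γ⊆Δ))
             (f′ (there ∘ ⊆-trans (xs⊆ys++xs V U) UV⊆Δ) (∷⁺ʳ _ Γ⊆Δ))

    compactness : Γ ⊢ᵀ A → _,_⊢ₜ_ Atom Th Γ A
    compactness d with finitelySupported d
    ... | T , t , d′ = T , t , d′ (xs⊆xs++ys _ _) (xs⊆ys++xs _ T)

  module _ (R : Polarized Atom) where
    open Axiomatic (Theory Atom R)

    Oriented : Sign Atom → Prop Atom → Prop Atom → Set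
    Oriented - A B = A ≼ B
    Oriented + A B = B ≼ A

    step-oriented : ∀ s → Step Atom R s A B → Oriented s A B
    step-oriented - (rule r) = ⇒E (axm (inj₁ (_ , r , refl)))
    step-oriented + (rule r) = ⇒E (axm (inj₂ (_ , r , refl)))
    step-oriented - (⇒ₗ st)  = ⇒-mono (step-oriented + st) id
    step-oriented + (⇒ₗ st)  = ⇒-mono (step-oriented - st) id
    step-oriented - (⇒ᵣ st)  = ⇒-mono id (step-oriented - st)
    step-oriented + (⇒ᵣ st)  = ⇒-mono id (step-oriented + st)
    step-oriented - (∧ₗ st)  = ∧-mono (step-oriented - st) id
    step-oriented + (∧ₗ st)  = ∧-mono (step-oriented + st) id
    step-oriented - (∧ᵣ st)  = ∧-mono id (step-oriented - st)
    step-oriented + (∧ᵣ st)  = ∧-mono id (step-oriented + st)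
    step-oriented - (∨ₗ st)  = ∨-mono (step-oriented - st) id
    step-oriented + (∨ₗ st)  = ∨-mono (step-oriented + st) id
    step-oriented - (∨ᵣ st)  = ∨-mono id (step-oriented - st)
    step-oriented + (∨ᵣ st)  = ∨-mono id (step-oriented + st)

    steps-oriented : ∀ s → Steps Atom R s A B → Oriented s A B
    steps-oriented - ε          = id
    steps-oriented + ε          = id
    steps-oriented - (st ◅ sts) = steps-oriented - sts ∘ step-oriented - st
    steps-oriented + (st ◅ sts) = step-oriented + st ∘ steps-oriented + sts

    axiomatize : Γ ⊢[ R ] A → Γ ⊢ᵀ A
    axiomatize (ax A∈Γ s t)  = steps-oriented + t (steps-oriented - s (hyp A∈Γ))
    axiomatize (⇒-i s d)     = steps-oriented + s (⇒I (axiomatize d))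
    axiomatize (⇒-e s d e)   = ⇒E (steps-oriented - s (axiomatize d)) (axiomatize e)
    axiomatize (∧-i s d e)   = steps-oriented + s (∧I (axiomatize d) (axiomatize e))
    axiomatize (∧-e₁ s d)    = ∧E₁ (steps-oriented - s (axiomatize d))
    axiomatize (∧-e₂ s d)    = ∧E₂ (steps-oriented - s (axiomatize d))
    axiomatize (∨-i₁ s d)    = steps-oriented + s (∨I₁ (axiomatize d))
    axiomatize (∨-i₂ s d)    = steps-oriented + s (∨I₂ (axiomatize d))
    axiomatize (∨-e s d e f) = ∨E (steps-oriented - s (axiomatize d)) (axiomatize e) (axiomatize f)
    axiomatize (⊥-e s d)     = ⊥E (steps-oriented - s (axiomatize d))

  infix 4 _⊑_
  _⊑_ : Polarized Atom → Polarized Atom → Set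
  R ⊑ R′ = ∀ s {r} → rules Atom R s r → rules Atom R′ s r

  ∅⊑ : ∅ Atom ⊑ R
  ∅⊑ - ()
  ∅⊑ + ()

  step-⊑ : R ⊑ R′ → Step Atom R s A B → Step Atom R′ s A B
  step-⊑ R⊑R′ (rule {s} r) = rule (R⊑R′ s r)
  step-⊑ R⊑R′ (⇒ₗ st)      = ⇒ₗ (step-⊑ R⊑R′ st)
  step-⊑ R⊑R′ (⇒ᵣ st)      = ⇒ᵣ (step-⊑ R⊑R′ st)
  step-⊑ R⊑R′ (∧ₗ st)      = ∧ₗ (step-⊑ R⊑R′ st)
  step-⊑ R⊑R′ (∧ᵣ st)      = ∧ᵣ (step-⊑ R⊑R′ st)
  step-⊑ R⊑R′ (∨ₗ st)      = ∨ₗ (step-⊑ R⊑R′ st)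
  step-⊑ R⊑R′ (∨ᵣ st)      = ∨ᵣ (step-⊑ R⊑R′ st)

  steps-⊑ : R ⊑ R′ → Steps Atom R s A B → Steps Atom R′ s A B
  steps-⊑ R⊑R′ = map (step-⊑ R⊑R′)

  ⊢-⊑ : R ⊑ R′ → Γ ⊢[ R ] A → Γ ⊢[ R′ ] A
  ⊢-⊑ R⊑R′ (ax A∈Γ s t)  = ax A∈Γ (steps-⊑ R⊑R′ s) (steps-⊑ R⊑R′ t)
  ⊢-⊑ R⊑R′ (⇒-i s d)     = ⇒-i (steps-⊑ R⊑R′ s) (⊢-⊑ R⊑R′ d)
  ⊢-⊑ R⊑R′ (⇒-e s d e)   = ⇒-e (steps-⊑ R⊑R′ s) (⊢-⊑ R⊑R′ d) (⊢-⊑ R⊑R′ e)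
  ⊢-⊑ R⊑R′ (∧-i s d e)   = ∧-i (steps-⊑ R⊑R′ s) (⊢-⊑ R⊑R′ d) (⊢-⊑ R⊑R′ e)
  ⊢-⊑ R⊑R′ (∧-e₁ s d)    = ∧-e₁ (steps-⊑ R⊑R′ s) (⊢-⊑ R⊑R′ d)
  ⊢-⊑ R⊑R′ (∧-e₂ s d)    = ∧-e₂ (steps-⊑ R⊑R′ s) (⊢-⊑ R⊑R′ d)
  ⊢-⊑ R⊑R′ (∨-i₁ s d)    = ∨-i₁ (steps-⊑ R⊑R′ s) (⊢-⊑ R⊑R′ d)
  ⊢-⊑ R⊑R′ (∨-i₂ s d)    = ∨-i₂ (steps-⊑ R⊑R′ s) (⊢-⊑ R⊑R′ d)
  ⊢-⊑ R⊑R′ (∨-e s d e f) =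
    ∨-e (steps-⊑ R⊑R′ s) (⊢-⊑ R⊑R′ d) (⊢-⊑ R⊑R′ e) (⊢-⊑ R⊑R′ f)
  ⊢-⊑ R⊑R′ (⊥-e s d)     = ⊥-e (steps-⊑ R⊑R′ s) (⊢-⊑ R⊑R′ d)

  cut : Γ ⊢[ R ] B → B ∷ Γ ⊢[ R ] A → Γ ⊢[ R ] A
  cut b d = ⇒-e ε (⇒-i ε d) b

  theory-derivable : Theory Atom R A → Γ ⊢[ R ] A
  theory-derivable (inj₁ (_ , r , refl)) = ⇒-i ε (ax (here refl) (rule r ◅ ε) ε)
  theory-derivable (inj₂ (_ , r , refl)) = ⇒-i ε (ax (here refl) ε (rule r ◅ ε))

  discharge : All (Theory Atom R) T → T ++ Γ ⊢[ R ] A → Γ ⊢[ R ] A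
  discharge []       d = d
  discharge (t ∷ ts) d = discharge ts (cut (theory-derivable t) d)

proposition6 : (Atom : Set) (R : Polarized Atom) → Commute Atom R →
    (Γ : List (Prop Atom)) (A : Prop Atom) →
    (_⊢_ Atom R Γ A) ⇔ (_,_⊢ₜ_ Atom (Theory Atom R) Γ A)
proposition6 Atom R _ _ _ = mk⇔
  (compactness ∘ axiomatize R)
  (λ { (T₀ , T₀⊆𝒯 , d) → discharge T₀⊆𝒯 (⊢-⊑ ∅⊑ d) })
  where open Axiomatic (Theory Atom R)
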